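{- For all $n\ge1$ and $(i,j)\in\mathbb Z^2$, $f_n(x_{i,j})=\psi_{1,n}(x_{i,j})$ equals the sum of the weights of all $n$-stair paths of $(i,j)$. Explicitly, $$\psi_{1,n}(x_{i,j})=\sum\left(x_{i-\sum_{s=1}^{k}l_s,\;j+\sum_{t=1}^{k}u_t}\prod_{v=1}^{k}\frac{x_{i+1-\sum_{s=1}^{v-1}l_s,\;j+\sum_{t=1}^{v-1}u_t}}{x_{i+1-\sum_{s=1}^{v}l_s,\;j+\sum_{t=1}^{v-1}u_t}}\cdot\frac{x_{i-\sum_{s=1}^{v}l_s,\;j-1+\sum_{t=1}^{v-1}u_t}}{x_{i-\sum_{s=1}^{v}l_s,\;j-1+\sum_{t=1}^{v}u_t}}\right),$$ where the sum is over all $k\ge1$ and integers $l_1\ge0$, $l_2,\dots,l_k\ge1$, $u_1,\dots,u_{k-1}\ge1$, $u_k\ge0$ with $\sum_{v=1}^k(l_v+u_v)=n$.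
   Context: Let $x_{i,j}$, $(i,j)\in\mathbb Z^2$, be independent variables. For integers $k\ge0$, $0\le t\le k+1$, define $\psi_{t,k}(x_{i,j})$ (Laurent polynomials in the variables) recursively by $\psi_{0,k}(x_{i,j})=\psi_{k+1,k}(x_{i,j})=x_{i,j}$, $$\psi_{1,1}(x_{i,j})=\frac{x_{i-1,j}x_{i+1,j}+x_{i,j-1}x_{i,j+1}}{x_{i,j}},$$ $$\psi_{t+1,k+2}(x_{i,j})=\frac{\psi_{t+1,k+1}(x_{i-1,j})\psi_{t,k+1}(x_{i+1,j})+\psi_{t,k+1}(x_{i,j-1})\psi_{t+1,k+1}(x_{i,j+1})}{\psi_{t,k}(x_{i,j})}\qquad(k\ge 0,\ 0\le t\le k+1).$$ **$n$-stair path of $(i,j)$.** An alternating sequence of left segments (horizontal segments directed left) and up segments (vertical segments directed up), of positive integer lengths with total length $n$, such that: - the first segment, left or up, has $(i,j)$ as its second lattice point (so its tail is $(i+1,j)$ if it is left, $(i,j-1)$ if it is up); - if a left segment ends at its head $(p,q)$, the next (up) segment has tail $(p-1,q-1)$; - if an up segment ends at its head $(p,q)$, the next (left) segment has tail $(p+1,q+1)$. The ending point $E$ is one further step (left, respectively up) beyond the head of the last segment. Thus $E=(i-\lambda,j+\mu)$ where $\lambda,\mu$ are the total lengths of the left and up segments. The weight of a segment from tail $a$ to head $b$ is $x_a/x_b$. The weight of a stair path is the product of its segment weights times $x_E$. -}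

module Defs where

open import Algebra.Bundles using (CommutativeRing)
open import Data.Empty using (⊥-elim)
open import Data.Fin.Base using (Fin; zero; suc; toℕ)
open import Data.Fin.Properties using (all?)
import Data.Integer.Base as ℤ
open ℤ using (ℤ; +_; 1ℤ)
import Data.Integer.Properties as ℤ
open import Data.List.Base
  using (List; []; _∷_; [_]; map; foldr; filter; deduplicate; concatMap; cartesianProductWith; take; upTo)
import Data.List.Properties as List
open import Data.List.NonEmpty.Base using (List⁺; _∷_; _∷⁺_; head; last; toList)
open import Data.List.Membership.Propositional using (_∈_; lose)
open import Data.List.Membership.Propositional.Properties
  using (∈-map⁺; ∈-concatMap⁺; ∈-cartesianProductWith⁺; ∈-upTo⁺; ∈-filter⁺; ∈-filter⁻; ∈-deduplicate⁺; ∈-deduplicate⁻)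
open import Data.List.Relation.Unary.Any using (here; there)
open import Data.List.Relation.Unary.Linked using (Linked; []; [-]; _∷_; linked?)
open import Data.List.Relation.Unary.Unique.Propositional using (Unique)
open import Data.List.Relation.Unary.Unique.DecPropositional.Properties using (deduplicate-!)
open import Data.Nat.Base
  using (ℕ; zero; suc; _≤_; _<_; z≤n; s≤s; NonZero)
  renaming (_+_ to _+ⁿ_)
import Data.Nat.Properties as ℕ
import Data.Nat.ListAction as List
open import Data.Product.Base using (Σ-syntax; _×_; _,_; proj₁; proj₂)
import Data.Product.Properties as Product
open import Data.Vec.Base as Vec using (Vec; []; _∷_; lookup)
import Data.Vec.Properties as Vec
open import Level using (0ℓ)
open import Relation.Binary.Definitions using (DecidableEquality)
open import Relation.Binary.PropositionalEquality
  using (_≡_; refl; sym; trans; cong; cong₂; subst)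
open import Relation.Nullary using (¬_; Dec; yes; no)
open import Relation.Nullary.Decidable using (map′; _×-dec_; _→-dec_)
open import Relation.Unary using (Pred; Decidable)

Point : Set
Point = ℤ × ℤ

------------------------------------------------------------------------
-- Laurent polynomials with integer coefficients in the variables x p,
-- p ∈ ℤ²: the commutative ring generated by all x p and x⁻¹ p, subject
-- to the relations x p * x⁻¹ p ≈ 1#.

infix  4 _≈_
infixl 6 _+_
infixl 7 _*_
infix  8 -_

data Laurent : Set where
  x x⁻¹   : Point → Laurent
  0# 1#   : Laurent
  _+_ _*_ : Laurent → Laurent → Laurent
  -_      : Laurent → Laurent

data _≈_ : Laurent → Laurent → Set where
  ≈-refl      : ∀ {a} → a ≈ a
  ≈-sym       : ∀ {a b} → a ≈ b → b ≈ a
  ≈-trans     : ∀ {a b c} → a ≈ b → b ≈ c → a ≈ c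
  +-cong      : ∀ {a b c d} → a ≈ b → c ≈ d → a + c ≈ b + d
  *-cong      : ∀ {a b c d} → a ≈ b → c ≈ d → a * c ≈ b * d
  -‿cong      : ∀ {a b} → a ≈ b → - a ≈ - b
  +-assoc     : ∀ a b c → (a + b) + c ≈ a + (b + c)
  +-comm      : ∀ a b → a + b ≈ b + a
  +-identityˡ : ∀ a → 0# + a ≈ a
  -‿inverseˡ  : ∀ a → - a + a ≈ 0#
  *-assoc     : ∀ a b c → (a * b) * c ≈ a * (b * c)
  *-comm      : ∀ a b → a * b ≈ b * a
  *-identityˡ : ∀ a → 1# * a ≈ a
  distribˡ    : ∀ a b c → a * (b + c) ≈ a * b + a * c
  x*x⁻¹       : ∀ p → x p * x⁻¹ p ≈ 1#

laurentRing : CommutativeRing 0ℓ 0ℓ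
laurentRing = record
  { Carrier = Laurent
  ; _≈_ = _≈_
  ; _+_ = _+_
  ; _*_ = _*_
  ; -_ = -_
  ; 0# = 0#
  ; 1# = 1#
  ; isCommutativeRing = record
    { isRing = record
      { +-isAbelianGroup = record
        { isGroup = record
          { isMonoid = record
            { isSemigroup = record
              { isMagma = record
                { isEquivalence = record { refl = ≈-refl ; sym = ≈-sym ; trans = ≈-trans }
                ; ∙-cong = +-cong
                }
              ; assoc = +-assoc
              }
            ; identity = +-identityˡ , λ a → ≈-trans (+-comm a 0#) (+-identityˡ a)
            }
          ; inverse = -‿inverseˡ , λ a → ≈-trans (+-comm a (- a)) (-‿inverseˡ a)
          ; ⁻¹-cong = -‿cong
          }
        ; comm = +-comm
        }
      ; *-cong = *-cong
      ; *-assoc = *-assoc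
      ; *-identity = *-identityˡ , λ a → ≈-trans (*-comm a 1#) (*-identityˡ a)
      ; distrib = distribˡ , λ a b c →
          ≈-trans (*-comm (b + c) a)
            (≈-trans (distribˡ a b c) (+-cong (*-comm a b) (*-comm a c)))
      }
    ; *-comm = *-comm
    }
  }

-- The quotient is unique when it exists, the ring being an integral domain.
infix 4 _≈_÷_
_≈_÷_ : Laurent → Laurent → Laurent → Set
f ≈ a ÷ b = (¬ b ≈ 0#) × (f * b ≈ a)

x[_]/x[_] : Point → Point → Laurent
x[ a ]/x[ b ] = x a * x⁻¹ b

∑ : ∀ {A : Set} → List A → (A → Laurent) → Laurent
∑ as w = foldr _+_ 0# (map w as)

∏ : ∀ {A : Set} → List A → (A → Laurent) → Laurent
∏ as w = foldr _*_ 1# (map w as)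

------------------------------------------------------------------------
-- Ψ t k i j f says that the recursion for ψ_{t,k}(x_{i,j}) can be
-- carried out in the ring of Laurent polynomials, and that f is its
-- value.  At most one constructor applies to given t and k; none does
-- when t > k + 1.

data Ψ : (t k : ℕ) (i j : ℤ) → Laurent → Set where
  bottom : ∀ {k i j f} → f ≈ x (i , j) → Ψ 0 k i j f
  top    : ∀ {k i j f} → f ≈ x (i , j) → Ψ (suc k) k i j f
  base   : ∀ {i j f} →
           f ≈ x (i ℤ.- 1ℤ , j) * x (i ℤ.+ 1ℤ , j) + x (i , j ℤ.- 1ℤ) * x (i , j ℤ.+ 1ℤ)
             ÷ x (i , j) →
           Ψ 1 1 i j f
  step   : ∀ {t k i j a b c d e f} → t ≤ suc k →
           Ψ (suc t) (suc k) (i ℤ.- 1ℤ) j a → Ψ t       (suc k) (i ℤ.+ 1ℤ) j b →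
           Ψ t       (suc k) i (j ℤ.- 1ℤ) c → Ψ (suc t) (suc k) i (j ℤ.+ 1ℤ) d →
           Ψ t k i j e →
           f ≈ a * b + c * d ÷ e →
           Ψ (suc t) (suc (suc k)) i j f

------------------------------------------------------------------------
-- Finite index sets

record Enumeration {A : Set} (P : Pred A 0ℓ) : Set where
  field
    list     : List A
    sound    : ∀ {a} → a ∈ list → P a
    complete : ∀ {a} → P a → a ∈ list
    unique   : Unique list

open Enumeration public using (list; sound; complete; unique)

enumerate : ∀ {A : Set} {P : Pred A 0ℓ} → DecidableEquality A → Decidable P →
            (candidates : List A) → (∀ {a} → P a → a ∈ candidates) → Enumeration P
enumerate _≟_ P? candidates covers = record
  { list     = deduplicate _≟_ (filter P? candidates)
  ; sound    = λ a∈ → proj₂ (∈-filter⁻ P? {xs = candidates} (∈-deduplicate⁻ _≟_ (filter P? candidates) a∈))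
  ; complete = λ pa → ∈-deduplicate⁺ _≟_ (∈-filter⁺ P? (covers pa) pa)
  ; unique   = deduplicate-! _≟_ (filter P? candidates)
  }

------------------------------------------------------------------------
-- Stair paths

data Direction : Set where
  left up : Direction

opposite : Direction → Direction
opposite left = up
opposite up   = left

move : Direction → ℕ → Point → Point
move left m (p , q) = p ℤ.- + m , q
move up   m (p , q) = p , q ℤ.+ + m

record Segment : Set where
  constructor segment
  field
    direction : Direction
    start     : Point
    len       : ℕ
    .{{len≢0}} : NonZero len

  end : Point
  end = move direction len start

open Segment public

-- The start of the next segment, after a segment in the given direction
-- that ends at the given point.
turn : Direction → Point → Point
turn left (p , q) = p ℤ.- 1ℤ , q ℤ.- 1ℤ
turn up   (p , q) = p ℤ.+ 1ℤ , q ℤ.+ 1ℤ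

infix 4 _▷_
_▷_ : Segment → Segment → Set
s ▷ s′ = direction s′ ≡ opposite (direction s) × start s′ ≡ turn (direction s) (end s)

IsStairPath : ℕ → Point → Pred (List⁺ Segment) 0ℓ
IsStairPath n p γ =
  move (direction (head γ)) 1 (start (head γ)) ≡ p ×
  Linked _▷_ (toList γ) ×
  List.sum (map len (toList γ)) ≡ n

endpoint : List⁺ Segment → Point
endpoint γ = move (direction (last γ)) 1 (end (last γ))

segmentWeight : Segment → Laurent
segmentWeight s = x[ start s ]/x[ end s ]

weight : List⁺ Segment → Laurent
weight γ = ∏ (toList γ) segmentWeight * x (endpoint γ)

private
  _≟ᵖ_ : DecidableEquality Point
  _≟ᵖ_ = Product.≡-dec ℤ._≟_ ℤ._≟_

  _≟ᵈ_ : DecidableEquality Direction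
  left ≟ᵈ left = yes refl
  left ≟ᵈ up   = no λ ()
  up   ≟ᵈ left = no λ ()
  up   ≟ᵈ up   = yes refl

  _≟ˢ_ : DecidableEquality Segment
  segment d a m ≟ˢ segment d′ a′ m′ =
    map′ (λ { (refl , refl , refl) → refl }) (λ { refl → refl , refl , refl })
      (d ≟ᵈ d′ ×-dec a ≟ᵖ a′ ×-dec m ℕ.≟ m′)

  _≟ᵞ_ : DecidableEquality (List⁺ Segment)
  (s ∷ ss) ≟ᵞ (s′ ∷ ss′) =
    map′ (λ { (refl , refl) → refl }) (λ { refl → refl , refl })
      (s ≟ˢ s′ ×-dec List.≡-dec _≟ˢ_ ss ss′)

  isStairPath? : ∀ n p → Decidable (IsStairPath n p)
  isStairPath? n p γ =
    (_ ≟ᵖ p) ×-dec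
    linked? (λ s s′ → (_ ≟ᵈ _) ×-dec (_ ≟ᵖ _)) (toList γ) ×-dec
    (_ ℕ.≟ n)

  -- All chains of segments of total length at most n with a given
  -- initial direction and starting point (together with some longer ones).
  chains : ℕ → Direction → Point → List (List⁺ Segment)
  chainsFrom : ℕ → Segment → List (List⁺ Segment)
  chains zero    d a = []
  chains (suc n) d a = concatMap (λ m → chainsFrom n (segment d a (suc m))) (upTo (suc n))
  chainsFrom n s = (s ∷ []) ∷ map (s ∷⁺_) (chains n (opposite (direction s)) (turn (direction s) (end s)))

  ∈-chains : ∀ n s ss → Linked _▷_ (s ∷ ss) → List.sum (map len (s ∷ ss)) ≤ n →
             (s ∷ ss) ∈ chains n (direction s) (start s)
  ∈-chains zero    (segment _ _ (suc _)) _  _   ()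
  ∈-chains (suc n) (segment d a (suc m)) [] [-] (s≤s le) =
    ∈-concatMap⁺ (λ m → chainsFrom n (segment d a (suc m)))
      (lose (∈-upTo⁺ (s≤s (ℕ.m+n≤o⇒m≤o m le))) (here refl))
  ∈-chains (suc n) (segment d a (suc m)) (s′@(segment _ _ _) ∷ ss) ((refl , refl) ∷ lk) (s≤s le) =
    ∈-concatMap⁺ (λ m → chainsFrom n (segment d a (suc m)))
      (lose (∈-upTo⁺ (s≤s (ℕ.m+n≤o⇒m≤o m le)))
      (there (∈-map⁺ (segment d a (suc m) ∷⁺_) (∈-chains n s′ ss lk (ℕ.m+n≤o⇒n≤o m le)))))

  unmove : Direction → Point → Point
  unmove left (i , j) = i ℤ.+ 1ℤ , j
  unmove up   (i , j) = i , j ℤ.- 1ℤ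

  unmove-move : ∀ d a → unmove d (move d 1 a) ≡ a
  unmove-move left (p , q) = cong (_, q)
    (trans (ℤ.+-assoc p (ℤ.- 1ℤ) 1ℤ) (ℤ.+-identityʳ p))
  unmove-move up   (p , q) = cong (p ,_)
    (trans (ℤ.+-assoc q 1ℤ (ℤ.- 1ℤ)) (ℤ.+-identityʳ q))

  stairPathCandidates : ℕ → Point → List (List⁺ Segment)
  stairPathCandidates n p =
    concatMap (λ d → chains n d (unmove d p)) (left ∷ up ∷ [])

  ∈-directions : ∀ d → d ∈ left ∷ up ∷ []
  ∈-directions left = here refl
  ∈-directions up   = there (here refl)

  ∈-stairPathCandidates : ∀ n p {γ} → IsStairPath n p γ → γ ∈ stairPathCandidates n p
  ∈-stairPathCandidates n p {s ∷ ss} (refl , lk , refl) =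
    ∈-concatMap⁺ (λ d → chains n d (unmove d p)) (lose (∈-directions (direction s))
      (subst (λ a → (s ∷ ss) ∈ chains n (direction s) a)
        (sym (unmove-move (direction s) (start s)))
        (∈-chains n s ss lk ℕ.≤-refl)))

stairPaths : ∀ n p → Enumeration (IsStairPath n p)
stairPaths n p =
  enumerate _≟ᵞ_ (isStairPath? n p) (stairPathCandidates n p) (∈-stairPathCandidates n p)

------------------------------------------------------------------------
-- The explicit sum

Lengths : Set
Lengths = Σ[ k ∈ ℕ ] (Vec ℕ k × Vec ℕ k)

-- Only l₁ and u_k may vanish; indices v : Fin k count from 0.
IsLengths : ℕ → Pred Lengths 0ℓ
IsLengths n (k , l , u) =
  1 ≤ k ×
  (∀ (v : Fin k) → 1 ≤ toℕ v → 1 ≤ lookup l v) ×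
  (∀ (v : Fin k) → suc (toℕ v) < k → 1 ≤ lookup u v) ×
  Vec.sum (Vec.zipWith _+ⁿ_ l u) ≡ n

partialSum : ∀ {k} → Vec ℕ k → ℕ → ℤ
partialSum l v = + List.sum (take v (Vec.toList l))

-- The factor at v is that of index v + 1 in the usual 1-based numbering.
lengthsTerm : ℤ → ℤ → Lengths → Laurent
lengthsTerm i j (k , l , u) =
  x (i ℤ.- L k , j ℤ.+ U k) *
  ∏ (upTo k) (λ v →
    x[ i ℤ.+ 1ℤ ℤ.- L v , j ℤ.+ U v ]/x[ i ℤ.+ 1ℤ ℤ.- L (suc v) , j ℤ.+ U v ] *
    x[ i ℤ.- L (suc v) , j ℤ.- 1ℤ ℤ.+ U v ]/x[ i ℤ.- L (suc v) , j ℤ.- 1ℤ ℤ.+ U (suc v) ])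
  where
  L U : ℕ → ℤ
  L = partialSum l
  U = partialSum u

private
  _≟ˡ_ : DecidableEquality Lengths
  _≟ˡ_ = Product.≡-dec ℕ._≟_ (Product.≡-dec (Vec.≡-dec ℕ._≟_) (Vec.≡-dec ℕ._≟_))

  isLengths? : ∀ n → Decidable (IsLengths n)
  isLengths? n (k , l , u) =
    (1 ℕ.≤? k) ×-dec
    all? (λ v → (1 ℕ.≤? toℕ v) →-dec (1 ℕ.≤? lookup l v)) ×-dec
    all? (λ v → (suc (toℕ v) ℕ.<? k) →-dec (1 ℕ.≤? lookup u v)) ×-dec
    (_ ℕ.≟ n)

  box : ℕ → (k : ℕ) → List (Vec ℕ k)
  box n zero    = [ [] ]
  box n (suc k) = cartesianProductWith _∷_ (upTo (suc n)) (box n k)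

  ∈-box : ∀ {n k} (w : Vec ℕ k) → Vec.sum w ≤ n → w ∈ box n k
  ∈-box []      _  = here refl
  ∈-box (a ∷ w) le = ∈-cartesianProductWith⁺ _∷_
    (∈-upTo⁺ (s≤s (ℕ.m+n≤o⇒m≤o a le))) (∈-box w (ℕ.m+n≤o⇒n≤o a le))

  sum-zipWith : ∀ {k} (l u : Vec ℕ k) →
                Vec.sum (Vec.zipWith _+ⁿ_ l u) ≡ Vec.sum l +ⁿ Vec.sum u
  sum-zipWith []      []      = refl
  sum-zipWith (a ∷ l) (b ∷ u) =
    trans (cong (a +ⁿ b +ⁿ_) (sum-zipWith l u)) (interchange a b (Vec.sum l) (Vec.sum u))
    where
    open import Algebra.Properties.CommutativeSemigroup ℕ.+-commutativeSemigroup using (interchange)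

  length≤sum : ∀ {k} (w : Vec ℕ k) → (∀ v → 1 ≤ lookup w v) → k ≤ Vec.sum w
  length≤sum []      _ = z≤n
  length≤sum (a ∷ w) h = ℕ.+-mono-≤ (h zero) (length≤sum w (λ v → h (suc v)))

  triple : ∀ k → Vec ℕ k → Vec ℕ k → Lengths
  triple k l u = k , l , u

  lengthsCandidates : ℕ → List Lengths
  lengthsCandidates n =
    concatMap (λ k → cartesianProductWith (triple k) (box n k) (box n k)) (upTo (suc (suc n)))

  ∈-lengthsCandidates : ∀ n {a} → IsLengths n a → a ∈ lengthsCandidates n
  ∈-lengthsCandidates n {suc k , l@(l₁ ∷ ls) , u} (_ , l≥1 , _ , total) =
    ∈-concatMap⁺ (λ k → cartesianProductWith (triple k) (box n k) (box n k))
      (lose (∈-upTo⁺ (s≤s (s≤s k≤n)))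
      (∈-cartesianProductWith⁺ (triple (suc k)) (∈-box l l≤n) (∈-box u u≤n)))
    where
    l+u≤n : Vec.sum l +ⁿ Vec.sum u ≤ n
    l+u≤n = ℕ.≤-reflexive (trans (sym (sum-zipWith l u)) total)
    l≤n : Vec.sum l ≤ n
    l≤n = ℕ.m+n≤o⇒m≤o (Vec.sum l) l+u≤n
    u≤n : Vec.sum u ≤ n
    u≤n = ℕ.m+n≤o⇒n≤o (Vec.sum l) l+u≤n
    k≤n : k ≤ n
    k≤n = ℕ.≤-trans (length≤sum ls (λ v → l≥1 (suc v) (s≤s z≤n))) (ℕ.m+n≤o⇒n≤o l₁ l≤n)

lengths : ∀ n → Enumeration (IsLengths n)
lengths n = enumerate _≟ˡ_ (isLengths? n) (lengthsCandidates n) (∈-lengthsCandidates n)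

-- For t = 0 the recursion only involves ψ_{1,·} and variables: it reads
--   f_{n+1}(i,j) = x_{i+1,j}/x_{i,j} f_n(i-1,j) + x_{i,j-1}/x_{i,j} f_n(i,j+1),  f_0 = x,
-- so f_n(i,j) is the sum over the 2ⁿ words of n unit steps left or up from
-- (i,j), a step being weighted by the quotient of the variables at its
-- shifted tail and at its origin.  Within a run of equal steps the weight
-- telescopes to a segment weight; grouping a word into maximal runs is a
-- bijection onto the stair paths, and recording the run lengths, with l₁ = 0
-- or u_k = 0 when the word starts up or ends left, is one onto the tuples of
-- lengths.

{-# OPTIONS --safe #-}
module Submission where

open import Algebra.Bundles using (CommutativeMonoid; CommutativeRing)
open import Data.Empty using (⊥-elim)
open import Data.Fin.Base using (Fin; zero; suc; toℕ)
import Data.Integer.Base as ℤ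
open import Data.Integer.Base using (ℤ)
import Data.Integer.Properties as ℤ
open import Data.Integer.Tactic.RingSolver using (solve-∀)
open import Data.List.Base as List using (List; []; _∷_; _++_; map; replicate; length; upTo; initLast; _∷ʳ′_)
import Data.List.Properties as List
open import Data.List.Membership.Propositional using (_∈_)
open import Data.List.Membership.Propositional.Properties using (∈-map⁺; ∈-map⁻; ∈-++⁺ˡ; ∈-++⁺ʳ; ∈-++⁻)
open import Data.List.Membership.Propositional.Properties.WithK using (unique∧set⇒bag)
open import Data.List.NonEmpty.Base using (List⁺; _∷_; last; toList)
open import Data.List.Relation.Binary.BagAndSetEquality using (∼bag⇒↭)
open import Data.List.Relation.Binary.Permutation.Propositional using (_↭_; refl; prep; swap; trans)
open import Data.List.Relation.Unary.All as All using (All; []; _∷_)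
import Data.List.Relation.Unary.All.Properties as All
open import Data.List.Relation.Unary.AllPairs using ([]; _∷_)
open import Data.List.Relation.Unary.Any using (here; there)
open import Data.List.Relation.Unary.Linked using (Linked; []; [-]; _∷_)
open import Data.List.Relation.Unary.Unique.Propositional using (Unique)
import Data.List.Relation.Unary.Unique.Propositional.Properties as Unique
import Data.Maybe.Properties as Maybe
open import Data.Maybe.Base using (just)
open import Data.Nat.Base using (ℕ; zero; suc; _≤_; _<_; z≤n; s≤s; s<s)
open import Data.Nat.ListAction using (sum)
import Data.Nat.Base as ℕ
import Data.Nat.Properties as ℕ
open import Data.Product.Base using (_×_; _,_; proj₁; proj₂; ∃-syntax)
open import Data.Sum.Base using (_⊎_; inj₁; inj₂; [_,_]′)
open import Data.Vec.Base as Vec using (Vec; []; _∷_; lookup)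
open import Function.Base using (_∘_)
open import Function.Bundles using (_⇔_; mk⇔; Equivalence)
open import Level using (0ℓ)
open import Relation.Binary.PropositionalEquality as ≡ using (_≡_; _≢_; cong; cong₂)
open import Relation.Nullary using (¬_)
open import Relation.Unary using (Pred)
open import Defs

private
  module R = CommutativeRing laurentRing
open import Algebra.Properties.CommutativeSemigroup R.*-commutativeSemigroup as * using ()
open import Algebra.Properties.CommutativeSemigroup
  (CommutativeMonoid.commutativeSemigroup R.+-commutativeMonoid) as + using ()
open import Relation.Binary.Reasoning.Setoid R.setoid hiding (start)

-- Fractions of variables

≡⇒≈ : ∀ {a b} → a ≡ b → a ≈ b
≡⇒≈ = R.reflexive

x⁻¹*x : ∀ p → x⁻¹ p * x p ≈ 1#
x⁻¹*x p = R.trans (*-comm _ _) (x*x⁻¹ p)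

-- Variables are units. For t = 0 every division in the recursion is by a variable, so this is what
-- makes the quotients unique there.
*x-cancel : ∀ {p f g} → f * x p ≈ g * x p → f ≈ g
*x-cancel {p} {f} {g} eq = begin
  f                    ≈⟨ expand f ⟩
  f * x p * x⁻¹ p      ≈⟨ R.*-congʳ eq ⟩
  g * x p * x⁻¹ p      ≈⟨ expand g ⟨
  g                    ∎
  where
  expand : ∀ h → h ≈ h * x p * x⁻¹ p
  expand h = begin
    h                  ≈⟨ R.*-identityʳ h ⟨
    h * 1#             ≈⟨ R.*-congˡ (x*x⁻¹ p) ⟨
    h * (x p * x⁻¹ p)  ≈⟨ *-assoc _ _ _ ⟨
    h * x p * x⁻¹ p    ∎

x/x*f*x : ∀ a p f → x[ a ]/x[ p ] * f * x p ≈ f * x a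
x/x*f*x a p f = begin
  x a * x⁻¹ p * f * x p      ≈⟨ *.xy∙z≈y∙xz _ _ _ ⟩
  f * (x a * x⁻¹ p * x p)    ≈⟨ R.*-congˡ (*-assoc _ _ _) ⟩
  f * (x a * (x⁻¹ p * x p))  ≈⟨ R.*-congˡ (R.*-congˡ (x⁻¹*x p)) ⟩
  f * (x a * 1#)             ≈⟨ R.*-congˡ (R.*-identityʳ _) ⟩
  f * x a                    ∎

x/x-telescope : ∀ a b c f → x[ a ]/x[ b ] * (x[ b ]/x[ c ] * f) ≈ x[ a ]/x[ c ] * f
x/x-telescope a b c f = begin
  x a * x⁻¹ b * (x b * x⁻¹ c * f)      ≈⟨ *-assoc _ _ _ ⟨
  x a * x⁻¹ b * (x b * x⁻¹ c) * f      ≈⟨ R.*-congʳ (*-assoc _ _ _) ⟩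
  x a * (x⁻¹ b * (x b * x⁻¹ c)) * f    ≈⟨ R.*-congʳ (R.*-congˡ (*-assoc _ _ _)) ⟨
  x a * (x⁻¹ b * x b * x⁻¹ c) * f      ≈⟨ R.*-congʳ (R.*-congˡ (R.*-congʳ (x⁻¹*x b))) ⟩
  x a * (1# * x⁻¹ c) * f               ≈⟨ R.*-congʳ (R.*-congˡ (*-identityˡ _)) ⟩
  x a * x⁻¹ c * f                      ∎

-- Since `_≈_` is generated inductively, an inequation needs a model. This is the ring homomorphism
-- to ℤ that sends every variable to 1.
evalAtOne : Laurent → ℤ
evalAtOne (x _)   = ℤ.1ℤ
evalAtOne (x⁻¹ _) = ℤ.1ℤ
evalAtOne 0#      = ℤ.0ℤ
evalAtOne 1#      = ℤ.1ℤ
evalAtOne (a + b) = evalAtOne a ℤ.+ evalAtOne b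
evalAtOne (a * b) = evalAtOne a ℤ.* evalAtOne b
evalAtOne (- a)   = ℤ.- evalAtOne a

evalAtOne-cong : ∀ {a b} → a ≈ b → evalAtOne a ≡ evalAtOne b
evalAtOne-cong ≈-refl           = ≡.refl
evalAtOne-cong (≈-sym p)        = ≡.sym (evalAtOne-cong p)
evalAtOne-cong (≈-trans p q)    = ≡.trans (evalAtOne-cong p) (evalAtOne-cong q)
evalAtOne-cong (+-cong p q)     = cong₂ ℤ._+_ (evalAtOne-cong p) (evalAtOne-cong q)
evalAtOne-cong (*-cong p q)     = cong₂ ℤ._*_ (evalAtOne-cong p) (evalAtOne-cong q)
evalAtOne-cong (-‿cong p)       = cong ℤ.-_ (evalAtOne-cong p)
evalAtOne-cong (+-assoc a b c)  = ℤ.+-assoc (evalAtOne a) (evalAtOne b) (evalAtOne c)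
evalAtOne-cong (+-comm a b)     = ℤ.+-comm (evalAtOne a) (evalAtOne b)
evalAtOne-cong (+-identityˡ a)  = ℤ.+-identityˡ (evalAtOne a)
evalAtOne-cong (-‿inverseˡ a)   = ℤ.+-inverseˡ (evalAtOne a)
evalAtOne-cong (*-assoc a b c)  = ℤ.*-assoc (evalAtOne a) (evalAtOne b) (evalAtOne c)
evalAtOne-cong (*-comm a b)     = ℤ.*-comm (evalAtOne a) (evalAtOne b)
evalAtOne-cong (*-identityˡ a)  = ℤ.*-identityˡ (evalAtOne a)
evalAtOne-cong (distribˡ a b c) = ℤ.*-distribˡ-+ (evalAtOne a) (evalAtOne b) (evalAtOne c)
evalAtOne-cong (x*x⁻¹ _)        = ≡.refl

-- Evaluation at one would give 1 = 0 in ℤ. This supplies the nonzero denominators that `_≈_÷_` asks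
-- for.
x≉0 : ∀ {p} → ¬ x p ≈ 0#
x≉0 eq with () ← evalAtOne-cong eq

-- Finite sums

module _ {A : Set} where

  ∑-++ : ∀ as bs (g : A → Laurent) → ∑ (as ++ bs) g ≈ ∑ as g + ∑ bs g
  ∑-++ []       bs g = R.sym (+-identityˡ _)
  ∑-++ (a ∷ as) bs g = R.trans (R.+-congˡ (∑-++ as bs g)) (R.sym (+-assoc _ _ _))

  ∑-distribˡ : ∀ c as (g : A → Laurent) → ∑ as (λ a → c * g a) ≈ c * ∑ as g
  ∑-distribˡ c []       g = R.sym (R.zeroʳ c)
  ∑-distribˡ c (a ∷ as) g = R.trans (R.+-congˡ (∑-distribˡ c as g)) (R.sym (distribˡ _ _ _))

  ∑-cong : ∀ as {g h : A → Laurent} → (∀ {a} → a ∈ as → g a ≈ h a) → ∑ as g ≈ ∑ as h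
  ∑-cong []       eq = ≈-refl
  ∑-cong (a ∷ as) eq = +-cong (eq (here ≡.refl)) (∑-cong as (eq ∘ there))

  ∑-↭ : ∀ {as bs} (g : A → Laurent) → as ↭ bs → ∑ as g ≈ ∑ bs g
  ∑-↭ g refl           = ≈-refl
  ∑-↭ g (prep a eq)    = R.+-congˡ (∑-↭ g eq)
  ∑-↭ g (swap a b eq)  = R.trans (R.+-congˡ (R.+-congˡ (∑-↭ g eq))) (+.x∙yz≈y∙xz _ _ _)
  ∑-↭ g (trans eq eq′) = R.trans (∑-↭ g eq) (∑-↭ g eq′)

∑-map : ∀ {A B : Set} (h : A → B) as (g : B → Laurent) → ∑ (map h as) g ≈ ∑ as (g ∘ h)
∑-map h as g = ≡⇒≈ (cong (List.foldr _+_ 0#) (≡.sym (List.map-∘ as)))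

-- Relative to a predicate because the word of a list of segments forgets starting points and that
-- of a tuple forgets zeros; only for stair paths and admissible lengths can these be recovered.
InjectiveOn : ∀ {A B : Set} → Pred A 0ℓ → (A → B) → Set
InjectiveOn P h = ∀ {a a′} → P a → P a′ → h a ≡ h a′ → a ≡ a′

unique-map⁺ : ∀ {A B : Set} {P : Pred A 0ℓ} {h : A → B} → InjectiveOn P h →
              ∀ {as} → All P as → Unique as → Unique (map h as)
unique-map⁺ inj []         []              = []
unique-map⁺ inj (pa ∷ pas) (a∉as ∷ unique) =
  All.map⁺ (All.zipWith (λ (pa′ , a≢a′) eq → a≢a′ (inj pa pa′ eq)) (pas , a∉as))
  ∷ unique-map⁺ inj pas unique

-- The image of `list E` under `h` has no repetitions and the same members as `list E′`, so the two
-- lists are permutations of each other.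
∑-bijection : ∀ {A B : Set} {P : Pred A 0ℓ} {Q : Pred B 0ℓ} (E : Enumeration P) (E′ : Enumeration Q)
              (h : A → B) → (∀ {a} → P a → Q (h a)) → InjectiveOn P h →
              (∀ {b} → Q b → ∃[ a ] P a × h a ≡ b) →
              ∀ {g g′} → (∀ {a} → P a → g a ≈ g′ (h a)) →
              ∑ (list E) g ≈ ∑ (list E′) g′
∑-bijection E E′ h P⇒Q inj surj {g} {g′} g≈g′ = begin
  ∑ (list E) g            ≈⟨ ∑-cong (list E) (g≈g′ ∘ sound E) ⟩
  ∑ (list E) (g′ ∘ h)     ≈⟨ ∑-map h (list E) g′ ⟨
  ∑ (map h (list E)) g′   ≈⟨ ∑-↭ g′ map-h-E↭E′ ⟩
  ∑ (list E′) g′          ∎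
  where
  to : ∀ {b} → b ∈ map h (list E) → b ∈ list E′
  to b∈ with a , a∈ , ≡.refl ← ∈-map⁻ h b∈ = complete E′ (P⇒Q (sound E a∈))

  from : ∀ {b} → b ∈ list E′ → b ∈ map h (list E)
  from b∈ with a , pa , ≡.refl ← surj (sound E′ b∈) = ∈-map⁺ h (complete E pa)

  map-h-E↭E′ : map h (list E) ↭ list E′
  map-h-E↭E′ = ∼bag⇒↭ (unique∧set⇒bag
    (unique-map⁺ inj (All.tabulate (sound E)) (unique E)) (unique E′) (mk⇔ to from))

-- Words of unit steps

-- The shifted tail of a step from the given point: a segment starts one unit behind the point where
-- its run of steps begins.
back : Direction → Point → Point
back left (i , j) = i ℤ.+ ℤ.1ℤ , j
back up   (i , j) = i , j ℤ.- ℤ.1ℤ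

back-move : ∀ d p → back d (move d 1 p) ≡ p
back-move left (i , j) = cong (_, j) (lemma i)
  where
  lemma : ∀ i → i ℤ.- ℤ.1ℤ ℤ.+ ℤ.1ℤ ≡ i
  lemma = solve-∀
back-move up   (i , j) = cong (i ,_) (lemma j)
  where
  lemma : ∀ i → i ℤ.+ ℤ.1ℤ ℤ.- ℤ.1ℤ ≡ i
  lemma = solve-∀

move-back : ∀ d p → move d 1 (back d p) ≡ p
move-back left (i , j) = cong (_, j) (lemma i)
  where
  lemma : ∀ i → i ℤ.+ ℤ.1ℤ ℤ.- ℤ.1ℤ ≡ i
  lemma = solve-∀
move-back up   (i , j) = cong (i ,_) (lemma j)
  where
  lemma : ∀ i → i ℤ.- ℤ.1ℤ ℤ.+ ℤ.1ℤ ≡ i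
  lemma = solve-∀

move-zero : ∀ d p → move d 0 p ≡ p
move-zero left (i , j) = cong (_, j) (ℤ.+-identityʳ i)
move-zero up   (i , j) = cong (i ,_) (ℤ.+-identityʳ j)

move-suc : ∀ d m p → move d m (move d 1 p) ≡ move d (suc m) p
move-suc left m (i , j) = cong (_, j) (lemma i (ℤ.+ m))
  where
  lemma : ∀ i m → i ℤ.- ℤ.1ℤ ℤ.- m ≡ i ℤ.- (ℤ.1ℤ ℤ.+ m)
  lemma = solve-∀
move-suc up   m (i , j) = cong (i ,_) (ℤ.+-assoc j ℤ.1ℤ (ℤ.+ m))

-- Successive segments of a stair path do not touch, but the walks do: one step past the end of a
-- segment is also one step past the start of the next.
move-turn : ∀ d p → move (opposite d) 1 (turn d p) ≡ move d 1 p
move-turn left (i , j) = cong (i ℤ.- ℤ.1ℤ ,_) (cong proj₂ (move-back up (i , j)))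
move-turn up   (i , j) = cong (_, j ℤ.+ ℤ.1ℤ) (cong proj₁ (move-back left (i , j)))

back-opposite : ∀ d p → back (opposite d) (move d 1 p) ≡ turn d p
back-opposite left p = ≡.refl
back-opposite up   p = ≡.refl

Word : Set
Word = List Direction

wordWeight : Point → Word → Laurent
wordWeight p []      = x p
wordWeight p (d ∷ w) = x[ back d p ]/x[ p ] * wordWeight (move d 1 p) w

-- Within a run the origin of each step is the shifted tail of the next, so the quotients telescope.
-- Here `a` is the shifted tail of the first step. The case m = 0 serves vanishing l₁ and u_k.
wordWeight-run : ∀ d m a w → wordWeight (move d 1 a) (replicate m d ++ w) ≈
                 x[ a ]/x[ move d m a ] * wordWeight (move d 1 (move d m a)) w
wordWeight-run d zero a w rewrite move-zero d a =
  R.sym (R.trans (R.*-congʳ (x*x⁻¹ a)) (*-identityˡ _))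
wordWeight-run d (suc m) a w rewrite back-move d a = begin
  x[ a ]/x[ a′ ] * wordWeight (move d 1 a′) (replicate m d ++ w)
    ≈⟨ R.*-congˡ (wordWeight-run d m a′ w) ⟩
  x[ a ]/x[ a′ ] * (x[ a′ ]/x[ move d m a′ ] * wordWeight (move d 1 (move d m a′)) w)
    ≈⟨ x/x-telescope a a′ (move d m a′) _ ⟩
  x[ a ]/x[ move d m a′ ] * wordWeight (move d 1 (move d m a′)) w
    ≡⟨ cong (λ b → x[ a ]/x[ b ] * wordWeight (move d 1 b) w) (move-suc d m a) ⟩
  x[ a ]/x[ move d (suc m) a ] * wordWeight (move d 1 (move d (suc m) a)) w ∎
  where
  a′ : Point
  a′ = move d 1 a

allWords : ℕ → List Word
allWords zero    = [] ∷ []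
allWords (suc n) = map (left ∷_) (allWords n) ++ map (up ∷_) (allWords n)

words : ∀ n → Enumeration (λ (w : Word) → length w ≡ n)
words n = record
  { list     = allWords n
  ; sound    = length-allWords n
  ; complete = λ { ≡.refl → ∈-allWords _ }
  ; unique   = unique-allWords n
  }
  where
  length-allWords : ∀ n {w} → w ∈ allWords n → length w ≡ n
  length-allWords zero    (here ≡.refl) = ≡.refl
  length-allWords (suc n) w∈ = [ length-map , length-map ]′ (∈-++⁻ (map (left ∷_) (allWords n)) w∈)
    where
    length-map : ∀ {d w} → w ∈ map (d ∷_) (allWords n) → length w ≡ suc n
    length-map {d} w∈ with w′ , w′∈ , ≡.refl ← ∈-map⁻ (d ∷_) w∈ = cong suc (length-allWords n w′∈)

  ∈-allWords : ∀ w → w ∈ allWords (length w)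
  ∈-allWords []         = here ≡.refl
  ∈-allWords (left ∷ w) = ∈-++⁺ˡ (∈-map⁺ (left ∷_) (∈-allWords w))
  ∈-allWords (up ∷ w)   = ∈-++⁺ʳ _ (∈-map⁺ (up ∷_) (∈-allWords w))

  unique-allWords : ∀ n → Unique (allWords n)
  unique-allWords zero    = [] ∷ []
  unique-allWords (suc n) = Unique.++⁺
    (Unique.map⁺ List.∷-injectiveʳ (unique-allWords n))
    (Unique.map⁺ List.∷-injectiveʳ (unique-allWords n))
    (λ (w∈ , w∈′) → disjoint (∈-map⁻ (left ∷_) w∈) (∈-map⁻ (up ∷_) w∈′))
    where
    disjoint : ∀ {w} → ∃[ v ] v ∈ allWords n × w ≡ left ∷ v →
               ¬ (∃[ v ] v ∈ allWords n × w ≡ up ∷ v)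
    disjoint (_ , _ , ≡.refl) (_ , _ , ())

wordSum : ℕ → Point → Laurent
wordSum n p = ∑ (list (words n)) (wordWeight p)

wordSum-zero : ∀ p → wordSum 0 p ≈ x p
wordSum-zero p = R.+-identityʳ _

-- Split the words by their first letter and clear the denominator. The products are arranged as in
-- `base` and in `step` for t = 0.
wordSum-suc : ∀ n i j → wordSum (suc n) (i , j) * x (i , j) ≈
              wordSum n (i ℤ.- ℤ.1ℤ , j) * x (i ℤ.+ ℤ.1ℤ , j) +
              x (i , j ℤ.- ℤ.1ℤ) * wordSum n (i , j ℤ.+ ℤ.1ℤ)
wordSum-suc n i j = begin
  wordSum (suc n) p * x p
    ≈⟨ R.*-congʳ (R.trans (∑-++ (map (left ∷_) (allWords n)) _ _) (+-cong (first left) (first up))) ⟩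
  (x[ back left p ]/x[ p ] * wordSum n (move left 1 p) + x[ back up p ]/x[ p ] * wordSum n (move up 1 p)) * x p
    ≈⟨ R.distribʳ _ _ _ ⟩
  x[ back left p ]/x[ p ] * wordSum n (move left 1 p) * x p + x[ back up p ]/x[ p ] * wordSum n (move up 1 p) * x p
    ≈⟨ +-cong (x/x*f*x _ _ _) (x/x*f*x _ _ _) ⟩
  wordSum n (move left 1 p) * x (back left p) + wordSum n (move up 1 p) * x (back up p)
    ≈⟨ R.+-congˡ (*-comm _ _) ⟩
  wordSum n (move left 1 p) * x (back left p) + x (back up p) * wordSum n (move up 1 p) ∎
  where
  p : Point
  p = i , j

  first : ∀ d → ∑ (map (d ∷_) (allWords n)) (wordWeight p) ≈ x[ back d p ]/x[ p ] * wordSum n (move d 1 p)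
  first d = R.trans (∑-map (d ∷_) (allWords n) _) (∑-distribˡ _ (allWords n) _)

-- The recursion for ψ_{1,n} and the sum over words

Ψ₀ : ∀ {k i j f} → Ψ 0 k i j f → f ≈ x (i , j)
Ψ₀ (bottom f≈x) = f≈x

-- Uniqueness of the value: both sides have the same product with x_{i,j}, by induction and
-- `wordSum-suc`.
Ψ⇒wordSum : ∀ n {i j f} → Ψ 1 (suc n) i j f → f ≈ wordSum (suc n) (i , j)
Ψ⇒wordSum zero {i} {j} (base (_ , f*x≈)) = *x-cancel (begin
  _  ≈⟨ f*x≈ ⟩
  -- The numerator in `base` is that of the general recursion with f_0 = x.
  _  ≈⟨ +-cong (R.*-congʳ (wordSum-zero _)) (R.*-congˡ (wordSum-zero _)) ⟨
  _  ≈⟨ wordSum-suc 0 i j ⟨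
  _  ∎)
Ψ⇒wordSum (suc n) {i} {j} {f} (step {a = a} {b} {c} {d} {e} _ ψa ψb ψc ψd ψe (_ , f*e≈)) = *x-cancel (begin
  f * x (i , j)  ≈⟨ R.*-congˡ (Ψ₀ ψe) ⟨
  f * e          ≈⟨ f*e≈ ⟩
  a * b + c * d  ≈⟨ +-cong (*-cong (Ψ⇒wordSum n ψa) (Ψ₀ ψb)) (*-cong (Ψ₀ ψc) (Ψ⇒wordSum n ψd)) ⟩
  _              ≈⟨ wordSum-suc (suc n) i j ⟨
  _              ∎)

-- Existence of the value: the word sums are Laurent polynomials that solve the recursion, so every
-- division in it can be carried out.
wordSum⇒Ψ : ∀ n {i j f} → f ≈ wordSum (suc n) (i , j) → Ψ 1 (suc n) i j f
wordSum⇒Ψ zero {i} {j} f≈ = base (x≉0 , (begin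
  _  ≈⟨ R.*-congʳ f≈ ⟩
  _  ≈⟨ wordSum-suc 0 i j ⟩
  _  ≈⟨ +-cong (R.*-congʳ (wordSum-zero _)) (R.*-congˡ (wordSum-zero _)) ⟩
  _  ∎))
wordSum⇒Ψ (suc n) {i} {j} f≈ =
  step z≤n (wordSum⇒Ψ n ≈-refl) (bottom ≈-refl) (bottom ≈-refl) (wordSum⇒Ψ n ≈-refl) (bottom ≈-refl)
    (x≉0 , R.trans (R.*-congʳ f≈) (wordSum-suc (suc n) i j))

Ψ⇔wordSum : ∀ n i j f → Ψ 1 (suc n) i j f ⇔ f ≈ wordSum (suc n) (i , j)
Ψ⇔wordSum n i j f = mk⇔ (Ψ⇒wordSum n) (wordSum⇒Ψ n)

-- Initial runs of a list

module _ {A : Set} {a : A} where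

  -- The condition on the heads makes the initial runs maximal, so their lengths can be read off the
  -- list.
  replicate-++-injective : ∀ m n {xs ys} → List.head xs ≢ just a → List.head ys ≢ just a →
                           replicate m a ++ xs ≡ replicate n a ++ ys → m ≡ n × xs ≡ ys
  replicate-++-injective zero    zero    _   _   eq     = ≡.refl , eq
  replicate-++-injective zero    (suc n) ≢a  _   ≡.refl = ⊥-elim (≢a ≡.refl)
  replicate-++-injective (suc m) zero    _   ≢a  ≡.refl = ⊥-elim (≢a ≡.refl)
  replicate-++-injective (suc m) (suc n) ≢a ≢a′ eq
    with ≡.refl , eq′ ← replicate-++-injective m n ≢a ≢a′ (List.∷-injectiveʳ eq) = ≡.refl , eq′

  length-replicate-++ : ∀ m xs → length (replicate m a ++ xs) ≡ m ℕ.+ length xs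
  length-replicate-++ m xs =
    ≡.trans (List.length-++ (replicate m a)) (cong (ℕ._+ length xs) (List.length-replicate m))

-- Words of stair paths

segmentsWord : List Segment → Word
segmentsWord []       = []
segmentsWord (s ∷ ss) = replicate (len s) (direction s) ++ segmentsWord ss

length-segmentsWord : ∀ ss → length (segmentsWord ss) ≡ sum (map len ss)
length-segmentsWord []       = ≡.refl
length-segmentsWord (s ∷ ss) =
  ≡.trans (length-replicate-++ (len s) _) (cong (len s ℕ.+_) (length-segmentsWord ss))

head-segmentsWord : ∀ s ss → List.head (segmentsWord (s ∷ ss)) ≡ just (direction s)
head-segmentsWord (segment _ _ (suc _)) ss = ≡.refl

opposite-≢ : ∀ d → opposite d ≢ d
opposite-≢ left ()
opposite-≢ up   ()

-- Directions alternate and lengths are positive, so the run of each segment is maximal.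
head-segmentsWord-tail : ∀ {s ss} → Linked _▷_ (s ∷ ss) → List.head (segmentsWord ss) ≢ just (direction s)
head-segmentsWord-tail {ss = []} _ ()
head-segmentsWord-tail {s} {s′ ∷ ss} ((opp , _) ∷ _) eq = opposite-≢ (direction s)
  (≡.trans (≡.sym opp) (Maybe.just-injective (≡.trans (≡.sym (head-segmentsWord s′ ss)) eq)))

-- Maximality of the runs determines the lengths; `_▷_` then passes directions and starting points
-- on from the first segment.
segmentsWord-injective : ∀ {s s′ ss ss′} → Linked _▷_ (s ∷ ss) → Linked _▷_ (s′ ∷ ss′) →
                         direction s ≡ direction s′ → start s ≡ start s′ →
                         segmentsWord (s ∷ ss) ≡ segmentsWord (s′ ∷ ss′) → _≡_ {A = List Segment} (s ∷ ss) (s′ ∷ ss′)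
segmentsWord-injective {segment d a m} {segment .d .a m′} linked linked′ ≡.refl ≡.refl eq
  with replicate-++-injective m m′ (head-segmentsWord-tail linked) (head-segmentsWord-tail linked′) eq
segmentsWord-injective [-] [-] _ _ _ | ≡.refl , _ = ≡.refl
-- If only one path goes on, an empty word would equal a nonempty one.
segmentsWord-injective [-] (_∷_ {y = s} {xs = ss} _ _) _ _ _ | ≡.refl , eq
  with () ← ≡.trans (cong List.head eq) (head-segmentsWord s ss)
segmentsWord-injective (_∷_ {y = s} {xs = ss} _ _) [-] _ _ _ | ≡.refl , eq
  with () ← ≡.trans (cong List.head (≡.sym eq)) (head-segmentsWord s ss)
segmentsWord-injective ((opp , turn) ∷ linked) ((opp′ , turn′) ∷ linked′) _ _ _ | ≡.refl , eq =
  cong (List._∷_ _) (segmentsWord-injective linked linked′ (≡.trans opp (≡.sym opp′)) (≡.trans turn (≡.sym turn′)) eq)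

pathWord : List⁺ Segment → Word
pathWord γ = segmentsWord (toList γ)

length-pathWord : ∀ {n p γ} → IsStairPath n p γ → length (pathWord γ) ≡ n
length-pathWord {γ = γ} (_ , _ , total) = ≡.trans (length-segmentsWord (toList γ)) total

move-injective : ∀ d {p q} → move d 1 p ≡ move d 1 q → p ≡ q
move-injective d {p} {q} eq = ≡.trans (≡.sym (back-move d p)) (≡.trans (cong (back d) eq) (back-move d q))

pathWord-injective : ∀ {n p} → InjectiveOn (IsStairPath n p) pathWord
pathWord-injective {a = s ∷ ss} {s′ ∷ ss′} (start≡ , linked , _) (start≡′ , linked′ , _) eq
  -- The first letter fixes the first direction, and with it `p` fixes the first starting point.
  with ≡.refl ← Maybe.just-injective (≡.trans (≡.sym (head-segmentsWord s ss))
                  (≡.trans (cong List.head eq) (head-segmentsWord s′ ss′)))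
  with ≡.refl ← segmentsWord-injective linked linked′ ≡.refl
                  (move-injective (direction s) (≡.trans start≡ (≡.sym start≡′))) eq = ≡.refl

same-or-opposite : ∀ d e → e ≡ d ⊎ e ≡ opposite d
same-or-opposite left left = inj₁ ≡.refl
same-or-opposite left up   = inj₂ ≡.refl
same-or-opposite up   left = inj₂ ≡.refl
same-or-opposite up   up   = inj₁ ≡.refl

-- Lets the first segment be prolonged at its start without disturbing the rest of the path.
relink : ∀ {s s′ ss} → direction s ≡ direction s′ → end s ≡ end s′ → Linked _▷_ (s ∷ ss) → Linked _▷_ (s′ ∷ ss)
relink dir≡ end≡ [-] = [-]
relink dir≡ end≡ ((opp , turn≡) ∷ linked) =
  (≡.trans opp (cong opposite dir≡) , ≡.trans turn≡ (cong₂ turn dir≡ end≡)) ∷ linked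

extendPath : ∀ d {n p γ} → IsStairPath n (move d 1 p) γ →
             ∃[ γ′ ] IsStairPath (suc n) p γ′ × pathWord γ′ ≡ d ∷ pathWord γ
extendPath d {p = p} {segment e a m ∷ ss} (start≡ , linked , total) with same-or-opposite d e
-- The new letter continues the first run: the first segment grows backwards by one unit.
... | inj₁ ≡.refl with ≡.refl ← move-injective d start≡ =
  segment d (back d p) (suc m) ∷ ss , (move-back d p , relink ≡.refl end≡ linked , cong suc total) , ≡.refl
  where
  end≡ : move d m p ≡ move d (suc m) (back d p)
  end≡ = ≡.trans (cong (move d m) (≡.sym (move-back d p))) (move-suc d m (back d p))
-- The new letter is a run of its own: a unit segment goes in front.
... | inj₂ ≡.refl =
  segment d (back d p) 1 ∷ segment e a m ∷ ss , (move-back d p , (≡.refl , turn≡) ∷ linked , cong suc total) , ≡.refl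
  where
  turn≡ : a ≡ turn d (move d 1 (back d p))
  turn≡ = ≡.trans (≡.sym (back-move (opposite d) a)) (≡.trans (cong (back (opposite d)) start≡)
    (≡.trans (back-opposite d p) (cong (turn d) (≡.sym (move-back d p)))))

-- The path is built from the last letter backwards. The word is nonempty because a stair path has
-- at least one segment.
pathWord-surjective : ∀ p d w → ∃[ γ ] IsStairPath (length (d ∷ w)) p γ × pathWord γ ≡ d ∷ w
pathWord-surjective p d [] = segment d (back d p) 1 ∷ [] , (move-back d p , [-] , ≡.refl) , ≡.refl
pathWord-surjective p d (e ∷ w)
  with γ , path , word≡ ← pathWord-surjective (move d 1 p) e w
  with γ′ , path′ , word≡′ ← extendPath d path =
  γ′ , path′ , ≡.trans word≡′ (cong (d ∷_) word≡)

last-∷ : ∀ {A : Set} (a b : A) bs → last (a ∷ b ∷ bs) ≡ last (b ∷ bs)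
last-∷ a b bs with initLast bs
... | []       = ≡.refl
... | _ ∷ʳ′ _  = ≡.refl

-- Each segment weight is the telescoped weight of its run, and `move-turn` matches the point where
-- one run ends with the point where the next begins.
weight-pathWord-linked : ∀ {s ss} → Linked _▷_ (s ∷ ss) →
                         weight (s ∷ ss) ≈ wordWeight (move (direction s) 1 (start s)) (segmentsWord (s ∷ ss))
weight-pathWord-linked {s} [-] = begin
  segmentWeight s * 1# * x (endpoint (s ∷ []))  ≈⟨ R.*-congʳ (R.*-identityʳ _) ⟩
  segmentWeight s * x (endpoint (s ∷ []))       ≈⟨ wordWeight-run (direction s) (len s) (start s) [] ⟨
  _                                             ∎
weight-pathWord-linked {s} (_∷_ {y = s′} {xs = ss} (opp , turn≡) linked) = begin
  segmentWeight s * ∏ (s′ ∷ ss) segmentWeight * x (endpoint (s ∷ s′ ∷ ss))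
    ≈⟨ *-assoc _ _ _ ⟩
  segmentWeight s * (∏ (s′ ∷ ss) segmentWeight * x (endpoint (s ∷ s′ ∷ ss)))
    ≡⟨ cong (λ r → segmentWeight s * (∏ (s′ ∷ ss) segmentWeight * x (move (direction r) 1 (end r)))) (last-∷ s s′ ss) ⟩
  segmentWeight s * weight (s′ ∷ ss)
    ≈⟨ R.*-congˡ (weight-pathWord-linked linked) ⟩
  segmentWeight s * wordWeight (move (direction s′) 1 (start s′)) (segmentsWord (s′ ∷ ss))
    ≡⟨ cong (λ q → segmentWeight s * wordWeight q (segmentsWord (s′ ∷ ss))) next ⟩
  segmentWeight s * wordWeight (move (direction s) 1 (end s)) (segmentsWord (s′ ∷ ss))
    ≈⟨ wordWeight-run (direction s) (len s) (start s) _ ⟨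
  _ ∎
  where
  next : move (direction s′) 1 (start s′) ≡ move (direction s) 1 (end s)
  next = ≡.trans (cong₂ (λ d → move d 1) opp turn≡) (move-turn (direction s) (end s))

weight-pathWord : ∀ {n p γ} → IsStairPath n p γ → weight γ ≈ wordWeight p (pathWord γ)
weight-pathWord {γ = _ ∷ _} (≡.refl , linked , _) = weight-pathWord-linked linked

stairPaths-wordSum : ∀ n p → ∑ (list (stairPaths (suc n) p)) weight ≈ wordSum (suc n) p
stairPaths-wordSum n p = ∑-bijection (stairPaths (suc n) p) (words (suc n))
  pathWord length-pathWord pathWord-injective
  (λ { {d ∷ w} ≡.refl → pathWord-surjective p d w }) weight-pathWord

-- Words of length vectors

runsWord : ∀ {k} → Vec ℕ k → Vec ℕ k → Word
runsWord []       []       = []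
runsWord (l ∷ ls) (u ∷ us) = replicate l left ++ replicate u up ++ runsWord ls us

length-runsWord : ∀ {k} (l u : Vec ℕ k) → length (runsWord l u) ≡ Vec.sum (Vec.zipWith ℕ._+_ l u)
length-runsWord []       []       = ≡.refl
length-runsWord (l ∷ ls) (u ∷ us) =
  ≡.trans (length-replicate-++ l _)
    (≡.trans (cong (l ℕ.+_) (≡.trans (length-replicate-++ u _) (cong (u ℕ.+_) (length-runsWord ls us))))
    (≡.sym (ℕ.+-assoc l u _)))

LeftPositive UpPositive : ∀ {k} → Vec ℕ k → Set
LeftPositive {k} l = ∀ (v : Fin k) → 1 ≤ toℕ v → 1 ≤ lookup l v
UpPositive   {k} u = ∀ (v : Fin k) → suc (toℕ v) < k → 1 ≤ lookup u v

leftPositive-tail : ∀ {k} l (ls : Vec ℕ k) → LeftPositive (l ∷ ls) → LeftPositive ls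
leftPositive-tail l ls l≥1 v _ = l≥1 (suc v) (s≤s z≤n)

upPositive-tail : ∀ {k} u (us : Vec ℕ k) → UpPositive (u ∷ us) → UpPositive us
upPositive-tail u us u≥1 v v< = u≥1 (suc v) (s<s v<)

-- Only l₁ may vanish, so a later block begins with a left step.
head-after-ups : ∀ {k} l (ls us : Vec ℕ k) → LeftPositive (l ∷ ls) → List.head (runsWord ls us) ≢ just up
head-after-ups l []           []      _   ()
head-after-ups l (zero ∷ _)   _       l≥1 with () ← l≥1 (suc zero) (s≤s z≤n)
head-after-ups l (suc _ ∷ _) (_ ∷ _) _   ()

-- Only u_k may vanish, so if there is no up step here, the word ends.
head-after-lefts : ∀ {k} (ls : Vec ℕ k) u us → UpPositive (u ∷ us) →
                   List.head (replicate u up ++ runsWord ls us) ≢ just left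
head-after-lefts []      zero    []      _   ()
head-after-lefts (_ ∷ _) zero    (_ ∷ _) u≥1 _ with () ← u≥1 zero (s<s (s≤s z≤n))
head-after-lefts _       (suc _) _       _   ()

runsWord-nonempty : ∀ {k} l (ls us : Vec ℕ (suc k)) → LeftPositive (l ∷ ls) → runsWord ls us ≢ []
runsWord-nonempty l (zero ∷ _)  _       l≥1 _ with () ← l≥1 (suc zero) (s≤s z≤n)
runsWord-nonempty l (suc _ ∷ _) (_ ∷ _) _   ()

-- The two runs of the first block are maximal, so both lengths are determined. The number of blocks
-- is too, as every further block has a nonempty word.
runsWord-injective : ∀ {k k′} (l u : Vec ℕ (suc k)) (l′ u′ : Vec ℕ (suc k′)) →
                     LeftPositive l → UpPositive u → LeftPositive l′ → UpPositive u′ →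
                     runsWord l u ≡ runsWord l′ u′ →
                     _≡_ {A = Lengths} (suc k , l , u) (suc k′ , l′ , u′)
runsWord-injective (l ∷ ls) (u ∷ us) (l′ ∷ ls′) (u′ ∷ us′) l≥1 u≥1 l≥1′ u≥1′ eq
  with ≡.refl , eq′ ← replicate-++-injective l l′
         (head-after-lefts ls u us u≥1) (head-after-lefts ls′ u′ us′ u≥1′) eq
  with ≡.refl , eq″ ← replicate-++-injective u u′
         (head-after-ups l ls us l≥1) (head-after-ups l ls′ us′ l≥1′) eq′
  with ls | us | ls′ | us′
... | []         | []         | []          | []          = ≡.refl
... | []         | []         | ls′@(_ ∷ _) | us′@(_ ∷ _) = ⊥-elim (runsWord-nonempty l ls′ us′ l≥1′ (≡.sym eq″))
... | ls@(_ ∷ _) | us@(_ ∷ _) | []          | []          = ⊥-elim (runsWord-nonempty l ls us l≥1 eq″)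
... | ls@(_ ∷ _) | us@(_ ∷ _) | ls′@(_ ∷ _) | us′@(_ ∷ _)
  with ≡.refl ← runsWord-injective ls us ls′ us′
         (leftPositive-tail l ls l≥1) (upPositive-tail u us u≥1)
         (leftPositive-tail l ls′ l≥1′) (upPositive-tail u us′ u≥1′) eq″ = ≡.refl

lengthsWord : Lengths → Word
lengthsWord (_ , l , u) = runsWord l u

length-lengthsWord : ∀ {n a} → IsLengths n a → length (lengthsWord a) ≡ n
length-lengthsWord {a = _ , l , u} (_ , _ , _ , total) = ≡.trans (length-runsWord l u) total

lengthsWord-injective : ∀ {n} → InjectiveOn (IsLengths n) lengthsWord
lengthsWord-injective {a = suc _ , l , u} {suc _ , l′ , u′} (_ , l≥1 , u≥1 , _) (_ , l≥1′ , u≥1′ , _) =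
  runsWord-injective l u l′ u′ l≥1 u≥1 l≥1′ u≥1′

lengthsWord-surjective : ∀ w → ∃[ a ] IsLengths (length w) a × lengthsWord a ≡ w
lengthsWord-surjective [] =
  -- At least one block is required; in a single block both l₁ and u₁ = u_k may vanish.
  (1 , 0 ∷ [] , 0 ∷ []) , (s≤s z≤n , (λ { zero () }) , (λ { zero (s≤s ()) }) , ≡.refl) , ≡.refl
lengthsWord-surjective (d ∷ w) with d | lengthsWord-surjective w
... | left | (suc k , l ∷ ls , u ∷ us) , (_ , l≥1 , u≥1 , total) , word≡ =
  (suc k , suc l ∷ ls , u ∷ us) ,
  (s≤s z≤n , (λ { (suc v) → l≥1 (suc v) }) , u≥1 , cong suc total) , cong (left ∷_) word≡
-- As l₁ = 0, the new step joins the up run of the first block.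
... | up | (suc k , zero ∷ ls , u ∷ us) , (_ , l≥1 , u≥1 , total) , word≡ =
  (suc k , zero ∷ ls , suc u ∷ us) ,
  (s≤s z≤n , (λ { (suc v) → l≥1 (suc v) }) , (λ { zero _ → s≤s z≤n ; (suc v) → u≥1 (suc v) }) , cong suc total) ,
  cong (up ∷_) word≡
-- The word begins with a left step, so a block with lengths 0 and 1 goes in front; the old l₁
-- becomes l₂ and is positive.
... | up | (suc k , suc l ∷ ls , u ∷ us) , (_ , l≥1 , u≥1 , total) , word≡ =
  (suc (suc k) , 0 ∷ suc l ∷ ls , 1 ∷ u ∷ us) ,
  (s≤s z≤n , (λ { (suc zero) _ → s≤s z≤n ; (suc (suc v)) _ → l≥1 (suc v) (s≤s z≤n) }) ,
   (λ { zero _ → s≤s z≤n ; (suc v) (s≤s v<) → u≥1 v v< }) , cong suc total) ,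
  cong (up ∷_) word≡

-- The terms of the explicit sum

∏-upTo-suc : ∀ k (g : ℕ → Laurent) → ∏ (upTo (suc k)) g ≡ g 0 * ∏ (upTo k) (g ∘ suc)
∏-upTo-suc k g = cong (λ as → g 0 * List.foldr _*_ 1# as)
  (≡.trans (List.map-applyUpTo suc g k) (≡.sym (List.map-upTo (g ∘ suc) k)))

lengthsFactor : ℤ → ℤ → ∀ {k} → Vec ℕ k → Vec ℕ k → ℕ → Laurent
lengthsFactor i j l u v =
  x[ i ℤ.+ ℤ.1ℤ ℤ.- L v , j ℤ.+ U v ]/x[ i ℤ.+ ℤ.1ℤ ℤ.- L (suc v) , j ℤ.+ U v ] *
  x[ i ℤ.- L (suc v) , j ℤ.- ℤ.1ℤ ℤ.+ U v ]/x[ i ℤ.- L (suc v) , j ℤ.- ℤ.1ℤ ℤ.+ U (suc v) ]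
  where
  L U : ℕ → ℤ
  L = partialSum l
  U = partialSum u

module _ (i j : ℤ) {k} (l u : ℕ) (ls us : Vec ℕ k) where

  private
    i′ j′ : ℤ
    -- The point `(i′ , j′)` is reached after the first block; measured from it, the partial sums
    -- begin anew.
    i′ = i ℤ.- ℤ.+ l
    j′ = j ℤ.+ ℤ.+ u

    shift-L : ∀ m → i ℤ.- ℤ.+ (l ℕ.+ m) ≡ i′ ℤ.- ℤ.+ m
    shift-L m = lemma i (ℤ.+ l) (ℤ.+ m)
      where
      lemma : ∀ i l m → i ℤ.- (l ℤ.+ m) ≡ i ℤ.- l ℤ.- m
      lemma = solve-∀

    shift-1+L : ∀ m → i ℤ.+ ℤ.1ℤ ℤ.- ℤ.+ (l ℕ.+ m) ≡ i′ ℤ.+ ℤ.1ℤ ℤ.- ℤ.+ m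
    shift-1+L m = lemma i (ℤ.+ l) (ℤ.+ m)
      where
      lemma : ∀ i l m → i ℤ.+ ℤ.1ℤ ℤ.- (l ℤ.+ m) ≡ i ℤ.- l ℤ.+ ℤ.1ℤ ℤ.- m
      lemma = solve-∀

    shift-U : ∀ m → j ℤ.+ ℤ.+ (u ℕ.+ m) ≡ j′ ℤ.+ ℤ.+ m
    shift-U m = ≡.sym (ℤ.+-assoc j (ℤ.+ u) (ℤ.+ m))

    shift-U-1 : ∀ m → j ℤ.- ℤ.1ℤ ℤ.+ ℤ.+ (u ℕ.+ m) ≡ j′ ℤ.- ℤ.1ℤ ℤ.+ ℤ.+ m
    shift-U-1 m = lemma j (ℤ.+ u) (ℤ.+ m)
      where
      lemma : ∀ j u m → j ℤ.- ℤ.1ℤ ℤ.+ (u ℤ.+ m) ≡ j ℤ.+ u ℤ.- ℤ.1ℤ ℤ.+ m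
      lemma = solve-∀

    x/x-cong : ∀ {a a′ b b′ c c′ d d′} → a ≡ a′ → b ≡ b′ → c ≡ c′ → d ≡ d′ →
               x[ a , b ]/x[ c , d ] ≡ x[ a′ , b′ ]/x[ c′ , d′ ]
    x/x-cong ≡.refl ≡.refl ≡.refl ≡.refl = ≡.refl

  lengthsFactor-zero : lengthsFactor i j (l ∷ ls) (u ∷ us) 0 ≡
    x[ i ℤ.+ ℤ.1ℤ , j ]/x[ i ℤ.+ ℤ.1ℤ ℤ.- ℤ.+ l , j ] * x[ i′ , j ℤ.- ℤ.1ℤ ]/x[ i′ , j ℤ.- ℤ.1ℤ ℤ.+ ℤ.+ u ]
  lengthsFactor-zero rewrite ℕ.+-identityʳ l | ℕ.+-identityʳ u = cong₂ _*_
    (x/x-cong (ℤ.+-identityʳ _) (ℤ.+-identityʳ _) ≡.refl (ℤ.+-identityʳ _))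
    (x/x-cong ≡.refl (ℤ.+-identityʳ _) ≡.refl ≡.refl)

  lengthsFactor-suc : ∀ v → lengthsFactor i j (l ∷ ls) (u ∷ us) (suc v) ≡ lengthsFactor i′ j′ ls us v
  lengthsFactor-suc v = cong₂ _*_
    (x/x-cong (shift-1+L _) (shift-U _) (shift-1+L _) (shift-U _))
    (x/x-cong (shift-L _) (shift-U-1 _) (shift-L _) (shift-U-1 _))

  -- Beyond the first block, the factors and the endpoint are those of the remaining tuple based at
  -- `(i′ , j′)`.
  lengthsTerm-∷ : lengthsTerm i j (suc k , l ∷ ls , u ∷ us) ≈
    lengthsFactor i j (l ∷ ls) (u ∷ us) 0 * lengthsTerm i′ j′ (k , ls , us)
  lengthsTerm-∷ = begin
    x (i ℤ.- partialSum (l ∷ ls) (suc k) , j ℤ.+ partialSum (u ∷ us) (suc k)) *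
      ∏ (upTo (suc k)) (lengthsFactor i j (l ∷ ls) (u ∷ us))
      ≡⟨ cong₂ _*_ (cong₂ (λ a b → x (a , b)) (shift-L _) (shift-U _)) (∏-upTo-suc k _) ⟩
    e * (f₀ * ∏ (upTo k) (lengthsFactor i j (l ∷ ls) (u ∷ us) ∘ suc))
      ≡⟨ cong (λ as → e * (f₀ * List.foldr _*_ 1# as)) (List.map-cong lengthsFactor-suc (upTo k)) ⟩
    e * (f₀ * ∏ (upTo k) (lengthsFactor i′ j′ ls us))
      ≈⟨ *.x∙yz≈y∙xz _ _ _ ⟩
    f₀ * (e * ∏ (upTo k) (lengthsFactor i′ j′ ls us)) ∎
    where
    e f₀ : Laurent
    e  = x (i′ ℤ.- partialSum ls k , j′ ℤ.+ partialSum us k)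
    f₀ = lengthsFactor i j (l ∷ ls) (u ∷ us) 0

-- Induction on the blocks, down to k = 0, where both sides reduce to the variable at the current
-- point. The two quotients of a block are the telescoped weights of its left run and its up run.
lengthsTerm-runsWord : ∀ i j {k} (l u : Vec ℕ k) → lengthsTerm i j (k , l , u) ≈ wordWeight (i , j) (runsWord l u)
lengthsTerm-runsWord i j [] [] =
  R.trans (R.*-identityʳ _) (≡⇒≈ (cong₂ (λ a b → x (a , b)) (ℤ.+-identityʳ i) (ℤ.+-identityʳ j)))
lengthsTerm-runsWord i j {suc k} (l ∷ ls) (u ∷ us) = begin
  lengthsTerm i j (suc k , l ∷ ls , u ∷ us)
    ≈⟨ lengthsTerm-∷ i j l u ls us ⟩
  lengthsFactor i j (l ∷ ls) (u ∷ us) 0 * lengthsTerm i′ j′ (k , ls , us)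
    ≈⟨ *-cong (≡⇒≈ (lengthsFactor-zero i j l u ls us)) (lengthsTerm-runsWord i′ j′ ls us) ⟩
  x[ a ]/x[ move left l a ] * x[ b ]/x[ move up u b ] * wordWeight (i′ , j′) w
    ≈⟨ *-assoc _ _ _ ⟩
  x[ a ]/x[ move left l a ] * (x[ b ]/x[ move up u b ] * wordWeight (i′ , j′) w)
    ≡⟨ cong (λ q → x[ a ]/x[ move left l a ] * (x[ b ]/x[ move up u b ] * wordWeight q w)) after-ups ⟨
  x[ a ]/x[ move left l a ] * (x[ b ]/x[ move up u b ] * wordWeight (move up 1 (move up u b)) w)
    ≈⟨ R.*-congˡ (wordWeight-run up u b w) ⟨
  x[ a ]/x[ move left l a ] * wordWeight (move up 1 b) (replicate u up ++ w)
    ≡⟨ cong (λ q → x[ a ]/x[ move left l a ] * wordWeight q (replicate u up ++ w)) after-lefts ⟨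
  x[ a ]/x[ move left l a ] * wordWeight (move left 1 (move left l a)) (replicate u up ++ w)
    ≈⟨ wordWeight-run left l a _ ⟨
  wordWeight (move left 1 a) (runsWord (l ∷ ls) (u ∷ us))
    ≡⟨ cong (λ q → wordWeight q (runsWord (l ∷ ls) (u ∷ us))) (move-back left (i , j)) ⟩
  wordWeight (i , j) (runsWord (l ∷ ls) (u ∷ us)) ∎
  where
  i′ j′ : ℤ
  i′ = i ℤ.- ℤ.+ l
  j′ = j ℤ.+ ℤ.+ u

  a b : Point
  -- The shifted tails of the left run and of the up run.
  a = back left (i , j)
  b = back up (i′ , j)

  w : Word
  w = runsWord ls us

  after-ups : move up 1 (move up u b) ≡ (i′ , j′)
  after-ups = cong (i′ ,_) (lemma j (ℤ.+ u))
    where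
    lemma : ∀ j u → j ℤ.- ℤ.1ℤ ℤ.+ u ℤ.+ ℤ.1ℤ ≡ j ℤ.+ u
    lemma = solve-∀

  after-lefts : move left 1 (move left l a) ≡ move up 1 b
  after-lefts = cong₂ _,_ (lemma i (ℤ.+ l)) (cong proj₂ (≡.sym (move-back up (i′ , j))))
    where
    lemma : ∀ i l → i ℤ.+ ℤ.1ℤ ℤ.- l ℤ.- ℤ.1ℤ ≡ i ℤ.- l
    lemma = solve-∀

lengths-wordSum : ∀ n i j → ∑ (list (lengths n)) (lengthsTerm i j) ≈ wordSum n (i , j)
lengths-wordSum n i j = ∑-bijection (lengths n) (words n)
  lengthsWord (λ {a} → length-lengthsWord {a = a}) lengthsWord-injective
  (λ { {w} ≡.refl → lengthsWord-surjective w })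
  (λ { {_ , l , u} _ → lengthsTerm-runsWord i j l u })

≈-respʳ-⇔ : ∀ {P : Set} {f a b} → a ≈ b → P ⇔ f ≈ b → P ⇔ f ≈ a
≈-respʳ-⇔ a≈b P⇔ = mk⇔ (λ p → R.trans (to p) (R.sym a≈b)) (λ f≈a → from (R.trans f≈a a≈b))
  where open Equivalence P⇔

proposition3p7 : (n : ℕ) → 1 ≤ n → (i j : ℤ) (f : Laurent) →
    (Ψ 1 n i j f ⇔ f ≈ ∑ (list (stairPaths n (i , j))) weight) ×
    (Ψ 1 n i j f ⇔ f ≈ ∑ (list (lengths n)) (lengthsTerm i j))
-- Both sums equal the sum over words, which the recursion characterizes.
proposition3p7 (suc n) _ i j f =
  ≈-respʳ-⇔ (stairPaths-wordSum n (i , j)) (Ψ⇔wordSum n i j f) ,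
  ≈-respʳ-⇔ (lengths-wordSum (suc n) i j) (Ψ⇔wordSum n i j f)
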